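{- Let $A\in\mathcal{V}$ and let $\theta,\chi\in Con(A)$ with $\theta\subseteq\chi$ and $Max(A)\cap[\theta)_A=Max(A)\cap[\chi)_A$. If $\chi$ has $CBLP$ then $\theta$ has $CBLP$.
   Context: $\mathcal{V}$ is a congruence modular, semidegenerate variety (no nontrivial algebra has a one-element subalgebra) of finite signature. For $B\in\mathcal{V}$: $Con(B)$ is its congruence lattice with bounds $\Delta_B,\nabla_B$, $[\cdot,\cdot]$ the Freese–McKenzie commutator, $K(B)$ the compact congruences. A congruence $\phi\neq\nabla_B$ is prime if $[\alpha,\beta]\subseteq\phi$ implies $\alpha\subseteq\phi$ or $\beta\subseteq\phi$; $\rho(\theta)$ is the intersection of prime congruences containing $\theta$; $Max(B)$ is the set of maximal congruences; $[\theta)_B=\{\chi\in Con(B):\theta\subseteq\chi\}$. $B(Con(B))$ is the Boolean algebra of complemented elements of $Con(B)$. When $K(B)$ is closed under the commutator, the reticulation $L(B)=K(B)/{\equiv}$ ($\alpha\equiv\beta$ iff $\rho(\alpha)=\rho(\beta)$) is a bounded distributive lattice with canonical map $\lambda_B$, mapping $B(Con(B))$ injectively into $B(L(B))$; the reticulation preserves the Boolean center if this map is onto $B(L(B))$. Standing assumption: for every $B\in\mathcal{V}$, $K(B)$ is closed under the commutator and the reticulation of $B$ preserves the Boolean center. A congruence $\theta$ of $A$ has $CBLP$ if for every $\beta\in B(Con(A/\theta))$ there is $\alpha\in B(Con(A))$ with $(\alpha\vee\theta)/\theta=\beta$. -}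

module Defs where

open import Level using (Level; _⊔_; suc; Lift; lift)
open import Data.Fin.Base using (Fin)
open import Data.List.Base using (List; []; _∷_; _++_; map; foldr)
open import Data.Nat.Base using (ℕ)
open import Data.Product.Base using (Σ; Σ-syntax; ∃-syntax; _×_; _,_; proj₁; proj₂)
open import Data.Sum.Base using (_⊎_; inj₁; inj₂; [_,_]′)
open import Data.Unit.Base using (⊤; tt)
open import Data.Vec.Functional using (Vector)
open import Relation.Binary.Bundles using (Setoid)
open import Relation.Binary.Core using (Rel; _⇒_)
open import Relation.Binary.Definitions using (Maximum; Minimum)
open import Relation.Binary.Lattice.Bundles using (Lattice; BoundedLattice)
open import Relation.Binary.Structures using (IsEquivalence)
open import Relation.Nullary.Negation.Core using (¬_)
open import Relation.Unary using (Pred)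

------------------------------------------------------------------------
-- Lattices

module _ {c ℓ₁ ℓ₂ : Level} (L : Lattice c ℓ₁ ℓ₂) where
  open Lattice L

  IsModular : Set (c ⊔ ℓ₁ ⊔ ℓ₂)
  IsModular = ∀ x y z → x ≤ z → (x ∨ y) ∧ z ≈ x ∨ (y ∧ z)

  -- The bounds are named by their universal property: x ∨ y is the
  -- top element and x ∧ y is the bottom element.
  IsComplemented : Pred Carrier (c ⊔ ℓ₂)
  IsComplemented x = ∃[ y ] Maximum _≤_ (x ∨ y) × Minimum _≤_ (x ∧ y)

------------------------------------------------------------------------
-- Algebras and varieties of finite signature

record Signature : Set where
  field
    symbols : ℕ
    arity   : Fin symbols → ℕ

module _ (S : Signature) where
  open Signature S

  data Term (X : Set) : Set where
    var : X → Term X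
    app : (f : Fin symbols) → Vector (Term X) (arity f) → Term X

  -- Equality is a setoid equality, so that quotient algebras exist.
  record Algebra (ℓ : Level) : Set (suc ℓ) where
    field
      setoid : Setoid ℓ ℓ
    open Setoid setoid public
    field
      nonempty : Carrier
      op       : (f : Fin symbols) → Vector Carrier (arity f) → Carrier
      op-cong  : ∀ f {x y : Vector Carrier (arity f)} →
                 (∀ i → x i ≈ y i) → op f x ≈ op f y

  -- The variety axiomatised by a set of identities in countably many
  -- variables.
  record Variety (ℓ : Level) : Set (suc ℓ) where
    field
      Identity : Term ℕ → Term ℕ → Set ℓ

module _ {S : Signature} {ℓ : Level} (A : Algebra S ℓ) where
  open Signature S
  open Algebra A

  ⟦_⟧ : {X : Set} → Term S X → (X → Carrier) → Carrier
  ⟦ var x    ⟧ ρ = ρ x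
  ⟦ app f ts ⟧ ρ = op f (λ i → ⟦ ts i ⟧ ρ)

  IsSubuniverse : Pred Carrier ℓ → Set ℓ
  IsSubuniverse P =
    (∀ {x y} → x ≈ y → P x → P y) ×
    (∀ f (x : Vector Carrier (arity f)) → (∀ i → P (x i)) → P (op f x))

  HasOneElementSubalgebra : Set ℓ
  HasOneElementSubalgebra = ∃[ e ] IsSubuniverse (_≈ e)

  IsNontrivial : Set ℓ
  IsNontrivial = ∃[ x ] ∃[ y ] ¬ (x ≈ y)

  record Congruence : Set (suc ℓ) where
    field
      rel           : Rel Carrier ℓ
      isEquivalence : IsEquivalence rel
      contains-≈    : _≈_ ⇒ rel
      compatible    : ∀ f {x y : Vector Carrier (arity f)} →
                      (∀ i → rel (x i) (y i)) → rel (op f x) (op f y)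

open Congruence public using (rel)

_∈ᵛ_ : {S : Signature} {ℓ : Level} → Algebra S ℓ → Variety S ℓ → Set ℓ
A ∈ᵛ V = ∀ s t → Variety.Identity V s t → ∀ ρ → ⟦ A ⟧ s ρ ≈ ⟦ A ⟧ t ρ
  where open Algebra A using (_≈_)

------------------------------------------------------------------------
-- Congruence lattice

module _ {S : Signature} {ℓ : Level} {A : Algebra S ℓ} where
  open Signature S
  open Algebra A using (Carrier; _≈_; op; op-cong)
    renaming (refl to ≈-refl)

  infix 4 _⊆_ _≐_

  _⊆_ : Rel (Congruence A) ℓ
  α ⊆ β = rel α ⇒ rel β

  _≐_ : Rel (Congruence A) ℓ
  α ≐ β = α ⊆ β × β ⊆ α

  data Generated (R : Rel Carrier ℓ) : Rel Carrier ℓ where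
    gen   : ∀ {x y} → R x y → Generated R x y
    eq    : ∀ {x y} → x ≈ y → Generated R x y
    sym   : ∀ {x y} → Generated R x y → Generated R y x
    trans : ∀ {x y z} → Generated R x y → Generated R y z → Generated R x z
    comp  : ∀ f {x y : Vector Carrier (arity f)} →
            (∀ i → Generated R (x i) (y i)) → Generated R (op f x) (op f y)

  Cg : Rel Carrier ℓ → Congruence A
  Cg R = record
    { rel           = Generated R
    ; isEquivalence = record { refl = eq ≈-refl ; sym = sym ; trans = trans }
    ; contains-≈    = eq
    ; compatible    = comp
    }

  Cg-least : ∀ {R} (θ : Congruence A) → R ⇒ rel θ → Cg R ⊆ θ
  Cg-least {R} θ R⊆θ = go
    where
    module θ = Congruence θ
    module E = IsEquivalence θ.isEquivalence
    go : Generated R ⇒ rel θ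
    go (gen r)     = R⊆θ r
    go (eq p)      = θ.contains-≈ p
    go (sym p)     = E.sym (go p)
    go (trans p q) = E.trans (go p) (go q)
    go (comp f ps) = θ.compatible f (λ i → go (ps i))

  Δ : Congruence A
  Δ = record
    { rel           = _≈_
    ; isEquivalence = Algebra.isEquivalence A
    ; contains-≈    = λ p → p
    ; compatible    = op-cong
    }

  ∇ : Congruence A
  ∇ = record
    { rel           = λ _ _ → Lift ℓ ⊤
    ; isEquivalence = record { refl = lift tt ; sym = λ _ → lift tt ; trans = λ _ _ → lift tt }
    ; contains-≈    = λ _ → lift tt
    ; compatible    = λ _ _ → lift tt
    }

  infixr 6 _∨_
  infixr 7 _∧_

  _∧_ : Congruence A → Congruence A → Congruence A
  α ∧ β = record
    { rel           = λ x y → rel α x y × rel β x y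
    ; isEquivalence = record
      { refl  = Eα.refl , Eβ.refl
      ; sym   = λ (p , q) → Eα.sym p , Eβ.sym q
      ; trans = λ (p , q) (p′ , q′) → Eα.trans p p′ , Eβ.trans q q′
      }
    ; contains-≈    = λ p → α.contains-≈ p , β.contains-≈ p
    ; compatible    = λ f ps → α.compatible f (λ i → proj₁ (ps i))
                             , β.compatible f (λ i → proj₂ (ps i))
    }
    where
    module α = Congruence α
    module β = Congruence β
    module Eα = IsEquivalence α.isEquivalence
    module Eβ = IsEquivalence β.isEquivalence

  _∨_ : Congruence A → Congruence A → Congruence A
  α ∨ β = Cg (λ x y → rel α x y ⊎ rel β x y)

  ⋁ : {I : Set ℓ} → (I → Congruence A) → Congruence A
  ⋁ θ = Cg (λ x y → ∃[ i ] rel (θ i) x y)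

  ∨-least : ∀ {α β} (γ : Congruence A) → α ⊆ γ → β ⊆ γ → α ∨ β ⊆ γ
  ∨-least γ p q = Cg-least γ λ { (inj₁ a) → p a ; (inj₂ b) → q b }

  -- Families indexed by Set ℓ suffice: every α is the join of the
  -- principal congruences of its pairs, which form such a family.
  IsCompact : Pred (Congruence A) (suc ℓ)
  IsCompact α = {I : Set ℓ} (θ : I → Congruence A) → α ⊆ ⋁ θ →
                Σ[ is ∈ List I ] α ⊆ foldr _∨_ Δ (map θ is)

  IsMax : Pred (Congruence A) (suc ℓ)
  IsMax μ = ¬ (μ ≐ ∇) × (∀ ν → ¬ (ν ≐ ∇) → μ ⊆ ν → μ ≐ ν)

  [_⟩ : Congruence A → Pred (Congruence A) ℓ
  [ θ ⟩ χ = θ ⊆ χ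

  ----------------------------------------------------------------------
  -- Commutator

  -- α centralizes β modulo δ (the term condition).
  Centralizes : (α β δ : Congruence A) → Set ℓ
  Centralizes α β δ =
    ∀ {m n} (t : Term S (Fin m ⊎ Fin n)) {a b : Vector Carrier m} {c d : Vector Carrier n} →
    (∀ i → rel α (a i) (b i)) → (∀ j → rel β (c j) (d j)) →
    rel δ (⟦ A ⟧ t [ a , c ]′) (⟦ A ⟧ t [ a , d ]′) →
    rel δ (⟦ A ⟧ t [ b , c ]′) (⟦ A ⟧ t [ b , d ]′)

  -- [ α , β ] is the least δ such that α centralizes β modulo δ, see
  -- commutator-centralizes and commutator-least. It is generated
  -- inductively because the intersection of all such δ lives one
  -- universe too high.
  data Commutator (α β : Congruence A) : Rel Carrier ℓ where
    eq    : ∀ {x y} → x ≈ y → Commutator α β x y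
    sym   : ∀ {x y} → Commutator α β x y → Commutator α β y x
    trans : ∀ {x y z} → Commutator α β x y → Commutator α β y z → Commutator α β x z
    comp  : ∀ f {x y : Vector Carrier (arity f)} →
            (∀ i → Commutator α β (x i) (y i)) → Commutator α β (op f x) (op f y)
    term  : ∀ {m n} (t : Term S (Fin m ⊎ Fin n)) {a b : Vector Carrier m} {c d : Vector Carrier n} →
            (∀ i → rel α (a i) (b i)) → (∀ j → rel β (c j) (d j)) →
            Commutator α β (⟦ A ⟧ t [ a , c ]′) (⟦ A ⟧ t [ a , d ]′) →
            Commutator α β (⟦ A ⟧ t [ b , c ]′) (⟦ A ⟧ t [ b , d ]′)

  [_,_] : Congruence A → Congruence A → Congruence A
  [ α , β ] = record
    { rel           = Commutator α β
    ; isEquivalence = record { refl = eq ≈-refl ; sym = sym ; trans = trans }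
    ; contains-≈    = eq
    ; compatible    = comp
    }

  commutator-centralizes : ∀ α β → Centralizes α β [ α , β ]
  commutator-centralizes α β = term

  commutator-least : ∀ {α β} δ → Centralizes α β δ → [ α , β ] ⊆ δ
  commutator-least {α} {β} δ C = go
    where
    module δ = Congruence δ
    module E = IsEquivalence δ.isEquivalence
    go : Commutator α β ⇒ rel δ
    go (eq p)         = δ.contains-≈ p
    go (sym p)        = E.sym (go p)
    go (trans p q)    = E.trans (go p) (go q)
    go (comp f ps)    = δ.compatible f (λ i → go (ps i))
    go (term t p q r) = C t p q (go r)

  eval-cong : (θ : Congruence A) {X : Set} (t : Term S X) {ρ σ : X → Carrier} →
              (∀ x → rel θ (ρ x) (σ x)) → rel θ (⟦ A ⟧ t ρ) (⟦ A ⟧ t σ)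
  eval-cong θ (var x)    p = p x
  eval-cong θ (app f ts) p = Congruence.compatible θ f (λ i → eval-cong θ (ts i) p)

  commutator⊆ˡ : ∀ α β → [ α , β ] ⊆ α
  commutator⊆ˡ α β = commutator-least α λ t p _ r →
    E.trans (E.sym (eval-cong α t λ { (inj₁ i) → p i ; (inj₂ _) → E.refl }))
      (E.trans r (eval-cong α t λ { (inj₁ i) → p i ; (inj₂ _) → E.refl }))
    where module E = IsEquivalence (Congruence.isEquivalence α)

  commutator⊆ʳ : ∀ α β → [ α , β ] ⊆ β
  commutator⊆ʳ α β = commutator-least β λ t _ q _ →
    eval-cong β t λ { (inj₁ _) → E.refl ; (inj₂ j) → q j }
    where module E = IsEquivalence (Congruence.isEquivalence β)

  IsPrime : Pred (Congruence A) (suc ℓ)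
  IsPrime φ = ¬ (φ ≐ ∇) × (∀ α β → [ α , β ] ⊆ φ → α ⊆ φ ⊎ β ⊆ φ)

  -- The intersection of the prime congruences containing θ; only a
  -- relation, since it is not valued in Set ℓ.
  radical : Congruence A → Rel Carrier (suc ℓ)
  radical θ x y = ∀ φ → IsPrime φ → θ ⊆ φ → rel φ x y

Con : {S : Signature} {ℓ : Level} → Algebra S ℓ → BoundedLattice (suc ℓ) ℓ ℓ
Con A = record
  { Carrier          = Congruence A
  ; _≈_              = _≐_
  ; _≤_              = _⊆_
  ; _∨_              = _∨_
  ; _∧_              = _∧_
  ; ⊤                = ∇
  ; ⊥                = Δ
  ; isBoundedLattice = record
    { isLattice = record
      { isPartialOrder = record
        { isPreorder = record
          { isEquivalence = record
            { refl  = (λ p → p) , (λ p → p)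
            ; sym   = λ (p , q) → q , p
            ; trans = λ (p , q) (p′ , q′) → (λ r → p′ (p r)) , (λ r → q (q′ r))
            }
          ; reflexive = proj₁
          ; trans     = λ p q r → q (p r)
          }
        ; antisym = λ p q → p , q
        }
      ; supremum = λ α β → (λ p → gen (inj₁ p)) , (λ p → gen (inj₂ p))
                         , λ γ p q → ∨-least {α = α} {β} γ p q
      ; infimum  = λ _ _ → proj₁ , proj₂ , λ _ p q r → p r , q r
      }
    ; maximum = λ _ _ → lift tt
    ; minimum = λ θ → Congruence.contains-≈ θ
    }
  }

-- Membership in B(Con(A)).
InBooleanCenter : {S : Signature} {ℓ : Level} (A : Algebra S ℓ) → Pred (Congruence A) (suc ℓ)
InBooleanCenter A = IsComplemented (BoundedLattice.lattice (Con A))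

------------------------------------------------------------------------
-- Reticulation

module _ {S : Signature} {ℓ : Level} (A : Algebra S ℓ) where

  K : Set (suc ℓ)
  K = Σ (Congruence A) IsCompact

  IsCommutatorClosed : Set (suc ℓ)
  IsCommutatorClosed = ∀ (α β : Congruence A) → IsCompact α → IsCompact β → IsCompact [ α , β ]

  private
    ⋁ˡ : List (Congruence A) → Congruence A
    ⋁ˡ = foldr _∨_ Δ

    ++-⊆ˡ : ∀ {I : Set ℓ} (θ : I → Congruence A) is js → ⋁ˡ (map θ is) ⊆ ⋁ˡ (map θ (is ++ js))
    ++-⊆ˡ θ []       js p = Congruence.contains-≈ (⋁ˡ (map θ js)) p
    ++-⊆ˡ θ (i ∷ is) js   =
      ∨-least {α = θ i} {⋁ˡ (map θ is)} (⋁ˡ (map θ (i ∷ is ++ js)))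
        (λ p → gen (inj₁ p)) (λ p → gen (inj₂ (++-⊆ˡ θ is js p)))

    ++-⊆ʳ : ∀ {I : Set ℓ} (θ : I → Congruence A) is js → ⋁ˡ (map θ js) ⊆ ⋁ˡ (map θ (is ++ js))
    ++-⊆ʳ θ []       js p = p
    ++-⊆ʳ θ (i ∷ is) js p = gen (inj₂ (++-⊆ʳ θ is js p))

  ∨-compact : (α β : Congruence A) → IsCompact α → IsCompact β → IsCompact (α ∨ β)
  ∨-compact α β cα cβ θ α∨β⊆ =
    let is , p = cα θ (λ r → α∨β⊆ (gen (inj₁ r)))
        js , q = cβ θ (λ r → α∨β⊆ (gen (inj₂ r)))
    in is ++ js , ∨-least {α = α} {β} (⋁ˡ (map θ (is ++ js)))
         (λ r → ++-⊆ˡ θ is js (p r)) (λ r → ++-⊆ʳ θ is js (q r))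

  private
    radical-mono : ∀ {α β : Congruence A} → α ⊆ β → radical α ⇒ radical β
    radical-mono α⊆β r φ φ-prime β⊆φ = r φ φ-prime (λ p → β⊆φ (α⊆β p))

    radical-∧ : ∀ (α β : Congruence A) {x y} → radical α x y → radical β x y → radical [ α , β ] x y
    radical-∧ α β p q φ φ-prime αβ⊆φ with proj₂ φ-prime α β αβ⊆φ
    ... | inj₁ α⊆φ = p φ φ-prime α⊆φ
    ... | inj₂ β⊆φ = q φ φ-prime β⊆φ

    extensive : ∀ (α : Congruence A) → rel α ⇒ radical α
    extensive α p φ _ α⊆φ = α⊆φ p

  -- L(A) = K(A)/≡, presented as the setoid K(A) with equality ≡, so
  -- that the canonical map λ_A is the identity on K(A). Joins and
  -- meets are λ(α) ∨ λ(β) = λ(α ∨ β) and λ(α) ∧ λ(β) = λ([ α , β ]).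
  Reticulation : IsCommutatorClosed → Lattice (suc ℓ) (suc ℓ) (suc ℓ)
  Reticulation closed = record
    { Carrier   = K
    ; _≈_       = λ (α , _) (β , _) → (radical α ⇒ radical β) × (radical β ⇒ radical α)
    ; _≤_       = λ (α , _) (β , _) → radical α ⇒ radical β
    ; _∨_       = λ (α , cα) (β , cβ) → α ∨ β , ∨-compact α β cα cβ
    ; _∧_       = λ (α , cα) (β , cβ) → [ α , β ] , closed α β cα cβ
    ; isLattice = record
      { isPartialOrder = record
        { isPreorder = record
          { isEquivalence = record
            { refl  = (λ p → p) , (λ p → p)
            ; sym   = λ (p , q) → q , p
            ; trans = λ (p , q) (p′ , q′) → (λ r → p′ (p r)) , (λ r → q (q′ r))
            }
          ; reflexive = proj₁
          ; trans     = λ p q r → q (p r)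
          }
        ; antisym = λ p q → p , q
        }
      ; supremum = λ (α , _) (β , _) →
            radical-mono {α} {α ∨ β} (λ p → gen (inj₁ p))
          , radical-mono {β} {α ∨ β} (λ p → gen (inj₂ p))
          , λ (γ , _) p q r φ φ-prime γ⊆φ → r φ φ-prime (∨-least {α = α} {β} φ
              (λ a → p (extensive α a) φ φ-prime γ⊆φ)
              (λ b → q (extensive β b) φ φ-prime γ⊆φ))
      ; infimum  = λ (α , _) (β , _) →
            radical-mono {[ α , β ]} {α} (commutator⊆ˡ α β)
          , radical-mono {[ α , β ]} {β} (commutator⊆ʳ α β)
          , λ _ p q r → radical-∧ α β (p r) (q r)
      }
    }

  -- λ_A maps B(Con(A)) onto B(L(A)).
  PreservesBooleanCenter : IsCommutatorClosed → Set (suc ℓ)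
  PreservesBooleanCenter closed =
    ∀ x → IsComplemented L x → Σ[ a ∈ K ] InBooleanCenter A (proj₁ a) × Lattice._≈_ L a x
    where
    L : Lattice (suc ℓ) (suc ℓ) (suc ℓ)
    L = Reticulation closed

------------------------------------------------------------------------
-- Quotients and the congruence Boolean lifting property

module _ {S : Signature} {ℓ : Level} (A : Algebra S ℓ) where

  _/_ : Congruence A → Algebra S ℓ
  _/_ θ = record
    { setoid   = record { isEquivalence = Congruence.isEquivalence θ }
    ; nonempty = Algebra.nonempty A
    ; op       = Algebra.op A
    ; op-cong  = Congruence.compatible θ
    }

module _ {S : Signature} {ℓ : Level} {A : Algebra S ℓ} where

  quotient : (θ γ : Congruence A) → θ ⊆ γ → Congruence (A / θ)
  quotient θ γ θ⊆γ = record
    { rel           = rel γ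
    ; isEquivalence = Congruence.isEquivalence γ
    ; contains-≈    = θ⊆γ
    ; compatible    = Congruence.compatible γ
    }

  CBLP : Pred (Congruence A) (suc ℓ)
  CBLP θ = ∀ (β : Congruence (A / θ)) → InBooleanCenter (A / θ) β →
    Σ[ α ∈ Congruence A ] InBooleanCenter A α × quotient θ (α ∨ θ) (λ p → gen (inj₂ p)) ≐ β

------------------------------------------------------------------------
-- Conditions on varieties

module _ {S : Signature} {ℓ : Level} (V : Variety S ℓ) where

  IsCongruenceModular : Set (suc ℓ)
  IsCongruenceModular = ∀ (B : Algebra S ℓ) → B ∈ᵛ V → IsModular (BoundedLattice.lattice (Con B))

  IsSemidegenerate : Set (suc ℓ)
  IsSemidegenerate = ∀ (B : Algebra S ℓ) → B ∈ᵛ V → IsNontrivial B → ¬ HasOneElementSubalgebra B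

{-# OPTIONS --safe #-}
module Submission where

-- Let β, γ be complements modulo θ. Then β ∨ χ, γ ∨ χ are complements
-- modulo χ, so β ∨ χ = α ∨ χ for some α with a complement α′ in Con(A).
-- Maximal congruences above θ lie above χ, hence none of them contains
-- (α ∨ θ) ∨ γ or β ∨ α′; both joins are therefore total, because a
-- semidegenerate variety of finite signature has enough maximal
-- congruences. Now α ∨ θ = β follows from the cancellation law
--   x ∨ y = ∇ and z ∧ y ⊆ x imply z ⊆ x.
-- Cancellation replaces the usual commutator calculus ([z , ∇] = z and
-- additivity): it is Gumm's shifting lemma combined with
-- semidegeneracy of the subalgebra z of A × A.

open import Defs
open import Level using (Level; _⊔_; Lift; lift; lower)
open import Axiom.ExcludedMiddle using (ExcludedMiddle)
open import Axiom.Extensionality.Propositional using (Extensionality)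
open import Data.Bool.Base using (Bool; T)
open import Data.Empty using (⊥-elim)
open import Data.Fin.Base using (Fin; zero; suc)
open import Data.Nat.Base using (ℕ; zero; suc)
open import Data.Product.Base using (Σ; Σ-syntax; ∃-syntax; _×_; _,_; proj₁; proj₂; swap)
open import Data.Sum.Base using (_⊎_; inj₁; inj₂)
open import Data.Unit.Base using (tt)
open import Data.Vec.Functional using (Vector; head; tail) renaming (_∷_ to _◂_)
open import Function.Base using (_∘_; id)
open import Function.Bundles using (mk⇔)
open import Relation.Binary.Construct.Closure.ReflexiveTransitive using (Star; ε; _◅_; _◅◅_; gmap; reverse)
open import Relation.Binary.Core using (Rel)
open import Relation.Binary.PropositionalEquality.Core as ≡ using (_≡_)
open import Relation.Binary.Structures using (IsEquivalence)
open import Relation.Nullary.Decidable using (Dec; yes; no; ⌊_⌋; toWitness; fromWitness; isYes≗does; does-⇔)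
open import Relation.Nullary.Negation.Core using (¬_; contradiction)
open import Relation.Unary using (Pred; _∩_) renaming (_≐_ to _≐ᵖ_)

-- Zorn's lemma; choice is available because ExcludedMiddle decides
-- arbitrary types and thus returns witnesses.

module Zorn
  (em : ∀ {p : Level} → ExcludedMiddle p) (ext : ∀ {a b : Level} → Extensionality a b)
  {a r : Level} {X : Set a} (_≤_ : Rel X r)
  (≤-refl : ∀ {x} → x ≤ x) (≤-trans : ∀ {x y z} → x ≤ y → y ≤ z → x ≤ z)
  where

  -- Subsets are `Bool`-valued so that quantifying over them does not raise the universe level of
  -- `Tower`, and the tower is itself such a subset.
  IsChain : (X → Bool) → Set (a ⊔ r)
  IsChain P = ∀ {x y} → T (P x) → T (P y) → x ≤ y ⊎ y ≤ x

  IsLub : (X → Bool) → X → Set (a ⊔ r)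
  IsLub P u = (∀ {x} → T (P x) → x ≤ u) × (∀ v → (∀ {x} → T (P x) → x ≤ v) → u ≤ v)

  -- The strict upper bound chosen for x depends only on the class of x,
  -- so that equivalent elements have equivalent successors.
  class : X → X → Bool
  class x z = ⌊ em {P = (z ≤ x) × (x ≤ z)} ⌋

  class-cong : ∀ {x y} → x ≤ y → y ≤ x → class x ≡ class y
  class-cong p q = ext λ z → ≡.trans (isYes≗does em) (≡.trans
    (does-⇔ (mk⇔ (λ (r , s) → ≤-trans r p , ≤-trans q s)
                 (λ (r , s) → ≤-trans r q , ≤-trans p s)) em em)
    (≡.sym (isYes≗does em)))

  StrictlyAbove : (X → Bool) → X → Set (a ⊔ r)
  StrictlyAbove C w = ∀ z → T (C z) → (z ≤ w) × ¬ (w ≤ z)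

  step : (C : X → Bool) → Dec (Σ X (StrictlyAbove C)) → X → X
  step C (yes (w , _)) x = w
  step C (no _)        x = x

  next : X → X
  next x = step (class x) em x

  self : ∀ x → T (class x x)
  self x = fromWitness (≤-refl , ≤-refl)

  next-inflationary : ∀ x → x ≤ next x
  next-inflationary x with em {P = Σ X (StrictlyAbove (class x))}
  ... | yes (w , above) = proj₁ (above x (self x))
  ... | no _            = ≤-refl

  next-cong : ∀ {x y} → x ≤ y → y ≤ x → next x ≤ next y
  next-cong {x} {y} p q = go (class-cong p q)
    where
    go : ∀ {C D} → C ≡ D → step C em x ≤ step D em y
    -- Once the classes are identified, both sides consult the same instance of `em` and so receive
    -- the same witness.
    go {C} ≡.refl with em {P = Σ X (StrictlyAbove C)}
    ... | yes _ = ≤-refl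
    ... | no _  = p

  -- A chosen successor is never below `x`, so at a fixed point there was no candidate to choose.
  next-fixed⇒maximal : ∀ x → next x ≤ x → ∀ y → x ≤ y → y ≤ x
  next-fixed⇒maximal x fixed y x≤y with em {P = Σ X (StrictlyAbove (class x))}
  ... | yes (w , above) = contradiction fixed (proj₂ (above x (self x)))
  ... | no none with em {P = y ≤ x}
  ...   | yes y≤x = y≤x
  ...   | no  y≰x = contradiction (y , above) none
    where
    above : StrictlyAbove (class x) y
    above z z∈ = let z≤x , x≤z = toWitness z∈ in
      ≤-trans z≤x x≤y , λ y≤z → y≰x (≤-trans y≤z z≤x)

  -- Keep the larger of two members at each stage. This brings the finitely many arguments of an
  -- operation into one congruence of a chain.
  chain-directed : ∀ {q P} → IsChain P → Σ[ x ∈ X ] T (P x) →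
    ∀ n (Q : Fin n → X → Set q) → (∀ i {x y} → x ≤ y → Q i x → Q i y) →
    (∀ i → Σ[ x ∈ X ] T (P x) × Q i x) → Σ[ x ∈ X ] T (P x) × (∀ i → Q i x)
  chain-directed chain (x , x∈) zero Q mono Qs = x , x∈ , λ ()
  chain-directed chain inhabited (suc n) Q mono Qs
    with x , x∈ , q  ← Qs zero
       | y , y∈ , qs ← chain-directed chain inhabited n (Q ∘ suc) (λ i → mono (suc i)) (Qs ∘ suc)
    with chain x∈ y∈
  ... | inj₁ x≤y = y , y∈ , λ { zero → mono zero x≤y q ; (suc i) → qs i }
  ... | inj₂ y≤x = x , x∈ , λ { zero → q ; (suc i) → mono (suc i) y≤x (qs i) }

  -- The tower starts at the limit of the empty subset, which is a least element.
  data Tower : X → Set (a ⊔ r) where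
    successor : ∀ {x} → Tower x → Tower (next x)
    limit     : ∀ {P u} → (∀ {x} → T (P x) → Tower x) → IsLub P u → Tower u

  -- Extreme points as in the proof of the Bourbaki-Witt theorem; the first alternative stands for
  -- the case where `y` is not strictly below `c`.
  IsExtreme : X → Set (a ⊔ r)
  IsExtreme c = ∀ {y} → Tower y → y ≤ c → c ≤ y ⊎ next y ≤ c

  extreme-comparable : ∀ {c} → IsExtreme c → ∀ {y} → Tower y → y ≤ c ⊎ next c ≤ y
  extreme-comparable ex (successor {z} z∈) with extreme-comparable ex z∈
  ... | inj₂ sc≤z = inj₂ (≤-trans sc≤z (next-inflationary z))
  ... | inj₁ z≤c with ex z∈ z≤c
  ...   | inj₁ c≤z  = inj₂ (next-cong c≤z z≤c)
  ...   | inj₂ sz≤c = inj₁ sz≤c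
  extreme-comparable {c} ex (limit {P} {u} P⊆ (upper , least))
    with em {P = ∃[ z ] T (P z) × next c ≤ z}
  ... | yes (z , z∈ , sc≤z) = inj₂ (≤-trans sc≤z (upper z∈))
  ... | no none             = inj₁ (least c below)
    where
    below : ∀ {x} → T (P x) → x ≤ c
    below {x} x∈ with extreme-comparable ex (P⊆ x∈)
    ... | inj₁ x≤c  = x≤c
    ... | inj₂ sc≤x = contradiction (x , x∈ , sc≤x) none

  tower-extreme : ∀ {c} → Tower c → IsExtreme c
  tower-extreme (successor {d} d∈) y∈ y≤sd with extreme-comparable (tower-extreme d∈) y∈
  ... | inj₂ sd≤y = inj₁ sd≤y
  ... | inj₁ y≤d with tower-extreme d∈ y∈ y≤d
  ...   | inj₁ d≤y  = inj₂ (next-cong y≤d d≤y)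
  ...   | inj₂ sy≤d = inj₂ (≤-trans sy≤d (next-inflationary d))
  tower-extreme (limit {P} {u} P⊆ (upper , least)) {y} y∈ y≤u
    with em {P = ∃[ z ] T (P z) × ¬ (z ≤ y)}
  ... | no none = inj₁ (least y below)
    where
    below : ∀ {x} → T (P x) → x ≤ y
    below {x} x∈ with em {P = x ≤ y}
    ... | yes x≤y = x≤y
    ... | no  x≰y = contradiction (x , x∈ , x≰y) none
  ... | yes (z , z∈ , z≰y) with extreme-comparable (tower-extreme (P⊆ z∈)) y∈
  ...   | inj₂ sz≤y = contradiction (≤-trans (next-inflationary z) sz≤y) z≰y
  ...   | inj₁ y≤z with tower-extreme (P⊆ z∈) y∈ y≤z
  ...     | inj₁ z≤y  = contradiction z≤y z≰y
  ...     | inj₂ sy≤z = inj₂ (≤-trans sy≤z (upper z∈))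

  zorn : (∀ P → IsChain P → Σ X (IsLub P)) → Σ[ m ∈ X ] (∀ y → m ≤ y → y ≤ m)
  -- `u` bounds the tower and belongs to it as a limit; hence `next u` belongs to it as well and
  -- lies below `u`.
  zorn lub = u , next-fixed⇒maximal u (proj₁ u-lub (fromWitness (successor u∈)))
    where
    tower : X → Bool
    tower x = ⌊ em {P = Tower x} ⌋
    chain : IsChain tower
    chain {x} {y} x∈ y∈ with extreme-comparable (tower-extreme (toWitness y∈)) (toWitness x∈)
    ... | inj₁ x≤y  = inj₁ x≤y
    ... | inj₂ sy≤x = inj₂ (≤-trans (next-inflationary y) sy≤x)
    u     = proj₁ (lub tower chain)
    u-lub = proj₂ (lub tower chain)
    u∈ : Tower u
    u∈ = limit {tower} toWitness u-lub

-- Algebras and congruences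

module _ {S : Signature} {ℓ : Level} where
  open Signature S

  module Rel-≈ {A : Algebra S ℓ} (α : Congruence A) = IsEquivalence (Congruence.isEquivalence α)

  IsTotal : {A : Algebra S ℓ} → Congruence A → Set ℓ
  IsTotal α = ∀ x y → rel α x y

  ∨-isTotal-mono : {A : Algebra S ℓ} (α β δ : Congruence A) →
    IsTotal (α ∨ β) → α ⊆ δ → β ⊆ δ → IsTotal δ
  ∨-isTotal-mono α β δ total α⊆δ β⊆δ x y = ∨-least {α = α} {β} δ α⊆δ β⊆δ (total x y)

  ∨-isTotal-comm : {A : Algebra S ℓ} (α β : Congruence A) → IsTotal (α ∨ β) → IsTotal (β ∨ α)
  ∨-isTotal-comm α β total =
    ∨-isTotal-mono α β (β ∨ α) total (λ p → gen (inj₂ p)) (λ p → gen (inj₁ p))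

  pullback : {A : Algebra S ℓ} (θ : Congruence A) → Congruence (A / θ) → Congruence A
  pullback θ β = record
    { rel           = rel β
    ; isEquivalence = Congruence.isEquivalence β
    ; contains-≈    = λ p → Congruence.contains-≈ β (Congruence.contains-≈ θ p)
    ; compatible    = Congruence.compatible β
    }

  -- The subalgebra of A × A whose universe is z.
  graph : {A : Algebra S ℓ} → Congruence A → Algebra S ℓ
  graph {A} z = record
    { setoid   = record
      { Carrier       = Σ[ p ∈ Carrier × Carrier ] rel z (proj₁ p) (proj₂ p)
      ; _≈_           = λ ((u , v) , _) ((u′ , v′) , _) → (u ≈ u′) × (v ≈ v′)
      ; isEquivalence = record
        { refl  = refl , refl
        ; sym   = λ (p , q) → A.sym p , A.sym q
        ; trans = λ (p , q) (p′ , q′) → A.trans p p′ , A.trans q q′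
        }
      }
    ; nonempty = (nonempty , nonempty) , Rel-≈.refl z
    ; op       = λ f x → (op f (proj₁ ∘ proj₁ ∘ x) , op f (proj₂ ∘ proj₁ ∘ x))
                       , Congruence.compatible z f (proj₂ ∘ x)
    ; op-cong  = λ f p → op-cong f (proj₁ ∘ p) , op-cong f (proj₂ ∘ p)
    }
    where
    module A = Algebra A
    open A using (Carrier; _≈_; refl; nonempty; op; op-cong)

  graph-product : {A : Algebra S ℓ} (z α β : Congruence A) → Congruence (graph z)
  graph-product z α β = record
    { rel           = λ ((u , v) , _) ((u′ , v′) , _) → rel α u u′ × rel β v v′
    ; isEquivalence = record
      { refl  = Rel-≈.refl α , Rel-≈.refl β
      ; sym   = λ (p , q) → Rel-≈.sym α p , Rel-≈.sym β q
      ; trans = λ (p , q) (p′ , q′) → Rel-≈.trans α p p′ , Rel-≈.trans β q q′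
      }
    ; contains-≈    = λ (p , q) → Congruence.contains-≈ α p , Congruence.contains-≈ β q
    ; compatible    = λ f p → Congruence.compatible α f (proj₁ ∘ p)
                            , Congruence.compatible β f (proj₂ ∘ p)
    }

  module _ {A B : Algebra S ℓ} where
    private
      module A = Algebra A
      module B = Algebra B

    eval-homo : (h : A.Carrier → B.Carrier) → (∀ f x → h (A.op f x) B.≈ B.op f (h ∘ x)) →
      {X : Set} (t : Term S X) (ρ : X → A.Carrier) → h (⟦ A ⟧ t ρ) B.≈ ⟦ B ⟧ t (h ∘ ρ)
    eval-homo h homo (var x)    ρ = B.refl
    eval-homo h homo (app f ts) ρ =
      B.trans (homo f _) (B.op-cong f λ i → eval-homo h homo (ts i) ρ)

  module _ (V : Variety S ℓ) (A : Algebra S ℓ) (A∈V : A ∈ᵛ V) where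
    private module A = Algebra A

    quotient-∈ᵛ : (θ : Congruence A) → (A / θ) ∈ᵛ V
    quotient-∈ᵛ θ s t s≈t ρ = θ.trans (θ.sym (eval s))
      (θ.trans (Congruence.contains-≈ θ (A∈V s t s≈t ρ)) (eval t))
      where
      module θ = Rel-≈ θ
      eval : ∀ t → rel θ (⟦ A ⟧ t ρ) (⟦ A / θ ⟧ t ρ)
      eval t = eval-homo {A} {A / θ} id (λ _ _ → θ.refl) t ρ

    graph-∈ᵛ : (z : Congruence A) → graph z ∈ᵛ V
    graph-∈ᵛ z s t s≈t ρ =
        A.trans (eval₁ s) (A.trans (A∈V s t s≈t _) (A.sym (eval₁ t)))
      , A.trans (eval₂ s) (A.trans (A∈V s t s≈t _) (A.sym (eval₂ t)))
      where
      eval₁ : ∀ t → proj₁ (proj₁ (⟦ graph z ⟧ t ρ)) A.≈ ⟦ A ⟧ t (proj₁ ∘ proj₁ ∘ ρ)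
      eval₁ t = eval-homo {graph z} {A} (proj₁ ∘ proj₁) (λ _ _ → A.refl) t ρ
      eval₂ : ∀ t → proj₂ (proj₁ (⟦ graph z ⟧ t ρ)) A.≈ ⟦ A ⟧ t (proj₂ ∘ proj₁ ∘ ρ)
      eval₂ t = eval-homo {graph z} {A} (proj₂ ∘ proj₁) (λ _ _ → A.refl) t ρ

  -- Joins of congruences as chains of steps

  module _ {A : Algebra S ℓ} (κ₁ κ₂ : Congruence A) where
    open Algebra A using (Carrier; op)

    Step : Rel Carrier ℓ
    Step x y = rel κ₁ x y ⊎ rel κ₂ x y

    private
      cons : (κ : Congruence A) {n : ℕ} {a b : Carrier} {v w : Vector Carrier n} →
        rel κ a b → (∀ i → rel κ (v i) (w i)) → ∀ i → rel κ ((a ◂ v) i) ((b ◂ w) i)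
      cons κ p ps zero    = p
      cons κ p ps (suc i) = ps i

      -- Vectors are functions, so `x` and `head x ◂ tail x` agree only pointwise; a `κ₁`-step
      -- bridges the gap.
      head-tail : ∀ {n} (x : Vector Carrier (suc n)) → ∀ i → rel κ₁ (x i) ((head x ◂ tail x) i)
      head-tail x zero    = Rel-≈.refl κ₁
      head-tail x (suc i) = Rel-≈.refl κ₁

    -- Change one coordinate at a time.
    steps-compatible : ∀ n (g : Vector Carrier n → Carrier) →
      (∀ {x y} → (∀ i → rel κ₁ (x i) (y i)) → rel κ₁ (g x) (g y)) →
      (∀ {x y} → (∀ i → rel κ₂ (x i) (y i)) → rel κ₂ (g x) (g y)) →
      ∀ {x y} → (∀ i → Star Step (x i) (y i)) → Star Step (g x) (g y)
    steps-compatible zero    g c₁ c₂ ps = inj₁ (c₁ λ ()) ◅ ε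
    steps-compatible (suc n) g c₁ c₂ {x} {y} ps =
         inj₁ (c₁ (head-tail x))
      ◅  gmap (λ a → g (a ◂ tail x))
           (λ { (inj₁ p) → inj₁ (c₁ (cons κ₁ p λ _ → Rel-≈.refl κ₁))
              ; (inj₂ p) → inj₂ (c₂ (cons κ₂ p λ _ → Rel-≈.refl κ₂)) })
           (ps zero)
      ◅◅ steps-compatible n (λ v → g (head y ◂ v))
           (λ p → c₁ (cons κ₁ (Rel-≈.refl κ₁) p)) (λ p → c₂ (cons κ₂ (Rel-≈.refl κ₂) p))
           (ps ∘ suc)
      ◅◅ inj₁ (c₁ (λ i → Rel-≈.sym κ₁ (head-tail y i))) ◅ ε

    -- Chains of steps form a congruence containing `κ₁` and `κ₂`, because operations are finitary.
    ∨⇒steps : ∀ {x y} → rel (κ₁ ∨ κ₂) x y → Star Step x y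
    ∨⇒steps = ∨-least {α = κ₁} {κ₂} steps (λ p → inj₁ p ◅ ε) (λ p → inj₂ p ◅ ε)
      where
      steps : Congruence A
      steps = record
        { rel           = Star Step
        ; isEquivalence = record
          { refl  = ε
          ; sym   = reverse λ { (inj₁ p) → inj₁ (Rel-≈.sym κ₁ p) ; (inj₂ p) → inj₂ (Rel-≈.sym κ₂ p) }
          ; trans = _◅◅_
          }
        ; contains-≈    = λ p → inj₁ (Congruence.contains-≈ κ₁ p) ◅ ε
        ; compatible    = λ f → steps-compatible (arity f) (op f)
            (Congruence.compatible κ₁ f) (Congruence.compatible κ₂ f)
        }

    ∨-preserves : ∀ {p} (P : Pred Carrier p) →
      (∀ {x y} → rel κ₁ x y → P x → P y) → (∀ {x y} → rel κ₂ x y → P x → P y) →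
      ∀ {x y} → rel (κ₁ ∨ κ₂) x y → P x → P y
    ∨-preserves P pres₁ pres₂ = go ∘ ∨⇒steps
      where
      go : ∀ {x y} → Star Step x y → P x → P y
      go ε              px = px
      go (inj₁ r ◅ rs) px = go rs (pres₁ r px)
      go (inj₂ r ◅ rs) px = go rs (pres₂ r px)

-- Consequences of congruence modularity and semidegeneracy

module _ {S : Signature} {ℓ : Level} (V : Variety S ℓ) (modular : IsCongruenceModular V) where

  -- The modular law is applied in the subalgebra `β` of the square of `A`; `η₂` is the kernel of
  -- the second projection.
  shifting-lemma : (A : Algebra S ℓ) → A ∈ᵛ V → (α β γ : Congruence A) → α ∧ β ⊆ γ →
    ∀ {a b c d} → rel α a b → rel α c d → rel β a c → rel β b d → rel γ a b → rel γ c d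
  shifting-lemma A A∈V α β γ αβ⊆γ {a} {b} {c} {d} aαb cαd aβc bβd aγb =
    proj₁ (proj₁ (∨-least {α = γ̂} {η₂ ∧ α̂} γ̂ id (λ {u} {v} → below {u} {v})
      (proj₁ (modular (graph β) (graph-∈ᵛ V A A∈V β) γ̂ η₂ α̂ (λ (p , q) → proj₂ p , q))
        (path , cαd , cαd))))
    where
    module β = Rel-≈ β
    γ̂ η₂ α̂ : Congruence (graph β)
    -- Meeting `γ` with `α` places `γ̂` below `α̂`, as the modular law requires.
    γ̂  = graph-product β (γ ∧ α) α
    η₂ = graph-product β ∇ Δ
    α̂  = graph-product β α α
    below : η₂ ∧ α̂ ⊆ γ̂
    below {(p , q) , pβq} {(p′ , q′) , p′βq′} ((_ , q≈q′) , pαp′ , qαq′) =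
      -- The first coordinates are `β`-related through the equal second coordinates.
      (αβ⊆γ (pαp′ , β.trans pβq (β.trans (Congruence.contains-≈ β q≈q′) (β.sym p′βq′))) , pαp′) , qαq′
    path : rel (γ̂ ∨ η₂) ((c , c) , β.refl) ((d , d) , β.refl)
    path = trans {y = (a , c) , aβc} (gen (inj₂ (lift tt , Algebra.refl A)))
      (trans {y = (b , d) , bβd} (gen (inj₁ ((aγb , aαb) , cαd)))
        (gen (inj₂ (lift tt , Algebra.refl A))))

module Semidegenerate
  (em : ∀ {p : Level} → ExcludedMiddle p)
  {S : Signature} {ℓ : Level} (V : Variety S ℓ) (semidegenerate : IsSemidegenerate V)
  where
  open Signature S

  -- Otherwise the class of `e` is a one-element subalgebra of the nontrivial algebra `A / κ`.
  idempotent-class⇒total : (A : Algebra S ℓ) → A ∈ᵛ V → (κ : Congruence A) (e : Algebra.Carrier A) →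
    (∀ f → rel κ (Algebra.op A f (λ _ → e)) e) → IsTotal κ
  idempotent-class⇒total A A∈V κ e idem x y with em {P = rel κ x y}
  ... | yes p = p
  ... | no ¬p = ⊥-elim (semidegenerate (A / κ) (quotient-∈ᵛ V A A∈V κ) (x , y , ¬p)
    (e , (λ p q → κ.trans (κ.sym p) q)
       , λ f v p → κ.trans (Congruence.compatible κ f p) (idem f)))
    where module κ = Rel-≈ κ

  -- Existence of maximal congruences

  module _ (ext : ∀ {a b : Level} → Extensionality a b)
    (A : Algebra S ℓ) (A∈V : A ∈ᵛ V) (θ : Congruence A) (θ-proper : ¬ IsTotal θ) where
    open Algebra A using (Carrier; nonempty; op)

    private
      X : Set (Level.suc ℓ)
      X = Σ[ α ∈ Congruence A ] θ ⊆ α × ¬ IsTotal α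

      _≤_ : Rel X ℓ
      (α , _) ≤ (β , _) = α ⊆ β

      open Zorn em ext {X = X} _≤_ id (λ p q r → q (p r))

      module _ (P : X → Bool) (chain : IsChain P) (inhabited : Σ[ x ∈ X ] T (P x)) where

        Union : Rel Carrier (Level.suc ℓ)
        Union x y = Σ[ α ∈ X ] T (P α) × rel (proj₁ α) x y

        directed : ∀ n (R : Fin n → Carrier × Carrier) →
          (∀ i → Union (proj₁ (R i)) (proj₂ (R i))) →
          Σ[ α ∈ X ] T (P α) × (∀ i → rel (proj₁ α) (proj₁ (R i)) (proj₂ (R i)))
        directed n R = chain-directed {P = P} (λ {x} {y} → chain {x} {y}) inhabited n
          (λ i α → rel (proj₁ α) (proj₁ (R i)) (proj₂ (R i))) (λ i p → p)

        -- Excluded middle brings the union down to Set ℓ.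
        ⋃ : Congruence A
        ⋃ = record
          { rel           = λ x y → Lift ℓ (T ⌊ em {P = Union x y} ⌋)
          ; isEquivalence = record
            { refl  = λ {x} → let α , α∈ = inhabited in
                        into (α , α∈ , Rel-≈.refl (proj₁ α) {x})
            ; sym   = λ p → let α , α∈ , r = out p in into (α , α∈ , Rel-≈.sym (proj₁ α) r)
            ; trans = λ {x} {y} {z} p q →
                let α , α∈ , r = directed 2 (λ { zero → x , y ; (suc _) → y , z })
                                   (λ { zero → out p ; (suc _) → out q })
                in into (α , α∈ , Rel-≈.trans (proj₁ α) (r zero) (r (suc zero)))
            }
          ; contains-≈    = λ p → let α , α∈ = inhabited in
                              into (α , α∈ , Congruence.contains-≈ (proj₁ α) p)
          ; compatible    = λ f {x} {y} p →
              let α , α∈ , r = directed (arity f) (λ i → x i , y i) (λ i → out (p i))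
              in into (α , α∈ , Congruence.compatible (proj₁ α) f r)
          }
          where
          into : ∀ {x y} → Union x y → Lift ℓ (T ⌊ em {P = Union x y} ⌋)
          into u = lift (fromWitness u)
          out : ∀ {x y} → Lift ℓ (T ⌊ em {P = Union x y} ⌋) → Union x y
          out (lift w) = toWitness w

        -- As there are finitely many operations, totality of the union
        -- is already witnessed by a member of the chain.
        ⋃-proper : ¬ IsTotal ⋃
        ⋃-proper total =
          let (α , _ , α-proper) , _ , r = directed symbols (λ f → op f (λ _ → nonempty) , nonempty)
                (λ f → toWitness (lower (total (op f (λ _ → nonempty)) nonempty)))
          in α-proper (idempotent-class⇒total A A∈V α nonempty r)

      lub : ∀ P → IsChain P → Σ X (IsLub P)
      lub P chain with em {P = Σ[ x ∈ X ] T (P x)}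
      -- The empty chain has the least element `θ` of `X` as its least upper bound.
      ... | no empty = (θ , id , θ-proper)
                     , (λ x∈ → ⊥-elim (empty (_ , x∈))) , (λ (_ , θ⊆ , _) _ → θ⊆)
      ... | yes i@((α , θ⊆α , _) , α∈) =
          (⋃ P chain i , (λ p → lift (fromWitness (_ , α∈ , θ⊆α p))) , ⋃-proper P chain i)
        , (λ x∈ p → lift (fromWitness (_ , x∈ , p)))
        , (λ v above p → let _ , x∈ , r = toWitness (lower p) in above x∈ r)

    ⊆-maximal : Σ[ μ ∈ Congruence A ] IsMax μ × θ ⊆ μ
    ⊆-maximal with zorn lub
    ... | (μ , θ⊆μ , μ-proper) , maximal = μ ,
      ( (λ (_ , ∇⊆μ) → μ-proper λ x y → ∇⊆μ (lift tt))
      , (λ ν ν≠∇ μ⊆ν → μ⊆ν ,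
          maximal (ν , (λ p → μ⊆ν (θ⊆μ p)) , λ total → ν≠∇ ((λ _ → lift tt) , λ _ → total _ _)) μ⊆ν))
      , θ⊆μ

  -- Cancellation for comaximal congruences

  module _ (modular : IsCongruenceModular V) (A : Algebra S ℓ) (A∈V : A ∈ᵛ V) where

    -- In the subalgebra z of A × A the diagonal lies in one class of
    -- x̂ ∨ ŷ, which is therefore total; but x ∩ z is a union of
    -- classes containing the diagonal.
    comaximal-cancel : (x y z : Congruence A) → IsTotal (x ∨ y) → z ∧ y ⊆ x → z ⊆ x
    comaximal-cancel x y z total zy⊆x {u} {v} uzv =
      ∨-preserves x̂ ŷ (λ ((u , v) , _) → rel x u v)
        (λ (p , q) r → X.trans (X.sym p) (X.trans r q))
        -- Two `ŷ`-related elements form a rectangle: each pair is `z`-related, and `y` relates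
        -- corresponding coordinates.
        (λ { {_ , r} {_ , r′} (p , q) → shifting-lemma V modular A A∈V z y x zy⊆x r r′ p q })
        (idempotent-class⇒total (graph z) (graph-∈ᵛ V A A∈V z) (x̂ ∨ ŷ) (diagonal nonempty)
          (λ f → trans (eq (refl , refl)) (diagonal-∨ (total _ _)))
          (diagonal u) ((u , v) , uzv))
        X.refl
      where
      module X = Rel-≈ x
      open Algebra A using (Carrier; nonempty; refl)
      x̂ ŷ : Congruence (graph z)
      x̂ = graph-product z x x
      ŷ = graph-product z y y
      diagonal : Carrier → Algebra.Carrier (graph z)
      diagonal a = (a , a) , Rel-≈.refl z
      diagonal-∨ : ∀ {a b} → rel (x ∨ y) a b → rel (x̂ ∨ ŷ) (diagonal a) (diagonal b)
      diagonal-∨ = ∨-least {α = x} {y} preimage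
        (λ p → gen (inj₁ (p , p))) (λ p → gen (inj₂ (p , p)))
        where
        preimage : Congruence A
        preimage = record
          { rel           = λ a b → rel (x̂ ∨ ŷ) (diagonal a) (diagonal b)
          ; isEquivalence = record { refl = eq (refl , refl) ; sym = sym ; trans = trans }
          ; contains-≈    = λ p → eq (p , p)
          -- The outer steps replace the membership proof in `z`, which equality in `graph z`
          -- ignores.
          ; compatible    = λ f p → trans (eq (refl , refl)) (trans (comp f p) (eq (refl , refl)))
          }

    -- Cancelling `c` puts `w` below `(w ∧ c) ∨ b`; the modular law then reduces the meet with `c`
    -- to `w ∧ c` and `b ∧ c`.
    comaximal-distrib : (b c w : Congruence A) → IsTotal (b ∨ c) → b ∧ c ⊆ w → (b ∨ w) ∧ c ⊆ w
    comaximal-distrib b c w total bc⊆w (p , q) =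
      ∨-least {α = w ∧ c} {b ∧ c} w proj₁ bc⊆w
        (proj₁ (modular A A∈V (w ∧ c) b c proj₂)
          (∨-least {α = b} {w} wc∨b (λ p → gen (inj₂ p)) w⊆wc∨b p , q))
      where
      wc∨b : Congruence A
      wc∨b = (w ∧ c) ∨ b
      w⊆wc∨b : w ⊆ wc∨b
      w⊆wc∨b = comaximal-cancel wc∨b c w
        (∨-isTotal-mono b c (wc∨b ∨ c) total (λ p → gen (inj₁ (gen (inj₂ p)))) (λ p → gen (inj₂ p)))
        (λ p → gen (inj₁ p))

    -- Cancelling `c` puts the meet `z` below `(z ∧ c) ∨ b`. By modularity `z` lies below the join
    -- of `z ∧ c` and `b ∧ z`, and `comaximal-distrib` bounds each by `w`.
    ∨-preserves-complements : (b c w : Congruence A) → IsTotal (b ∨ c) → b ∧ c ⊆ w →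
      (b ∨ w) ∧ (c ∨ w) ⊆ w
    ∨-preserves-complements b c w total bc⊆w p =
      ∨-least {α = z ∧ c} {b ∧ z} w
        (λ ((q , _) , r) → comaximal-distrib b c w total bc⊆w (q , r))
        (λ (r , (_ , q)) → comaximal-distrib c b w (∨-isTotal-comm b c total) (λ r → bc⊆w (swap r)) (q , r))
        (proj₁ (modular A A∈V (z ∧ c) b z proj₁) (z⊆zc∨b p , p))
      where
      z zc∨b : Congruence A
      z    = (b ∨ w) ∧ (c ∨ w)
      zc∨b = (z ∧ c) ∨ b
      z⊆zc∨b : z ⊆ zc∨b
      z⊆zc∨b = comaximal-cancel zc∨b c z
        (∨-isTotal-mono b c (zc∨b ∨ c) total (λ p → gen (inj₁ (gen (inj₂ p)))) (λ p → gen (inj₂ p)))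
        (λ p → gen (inj₁ p))

-- Lifting complemented congruences

theorem5p12 : (∀ {p : Level} → ExcludedMiddle p) →
    (∀ {a b : Level} → Extensionality a b) →
    ∀ {S : Signature} {ℓ : Level} (V : Variety S ℓ) →
    IsCongruenceModular V →
    IsSemidegenerate V →
    (closed : ∀ (B : Algebra S ℓ) → B ∈ᵛ V → IsCommutatorClosed B) →
    (∀ (B : Algebra S ℓ) (B∈V : B ∈ᵛ V) → PreservesBooleanCenter B (closed B B∈V)) →
    ∀ (A : Algebra S ℓ) → A ∈ᵛ V →
    (θ χ : Congruence A) → θ ⊆ χ →
    (IsMax ∩ [ θ ⟩) ≐ᵖ (IsMax ∩ [ χ ⟩) →
    CBLP χ → CBLP θ
theorem5p12 em ext V modular semidegenerate _ _ A A∈V θ χ θ⊆χ max≐ χ-CBLP β (γ , β∨γ-max , β∧γ-min) =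
  α , (α′ , α∨α′-max , α∧α′-min) , lifted
  where
  open Semidegenerate em V semidegenerate

  total-if-no-maximal : (κ : Congruence A) → (∀ μ → IsMax μ → κ ⊆ μ → IsTotal μ) → IsTotal κ
  total-if-no-maximal κ none with em {P = IsTotal κ}
  ... | yes total = total
  ... | no proper = let μ , (μ≠∇ , maximal) , κ⊆μ = ⊆-maximal ext A A∈V κ proper in
    ⊥-elim (μ≠∇ ((λ _ → lift tt) , λ _ → none μ (μ≠∇ , maximal) κ⊆μ _ _))

  β↓ γ↓ : Congruence A
  β↓ = pullback θ β
  γ↓ = pullback θ γ

  β∨γ-total : IsTotal (β↓ ∨ γ↓)
  β∨γ-total x y =
    -- The join in `A / θ` also absorbs `θ`, but `θ` is already contained in `β`.
    ∨-least {α = β} {γ} (quotient θ (β↓ ∨ γ↓) (λ p → gen (inj₁ (Congruence.contains-≈ β p))))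
      (λ p → gen (inj₁ p)) (λ p → gen (inj₂ p)) (β∨γ-max ∇ (lift tt))

  β∧γ⊆θ : β↓ ∧ γ↓ ⊆ θ
  -- `Δ` is taken in `A / θ`, where its relation is that of `θ`.
  β∧γ⊆θ = β∧γ-min Δ

  βχ γχ : Congruence (A / χ)
  βχ = quotient χ (β↓ ∨ χ) (λ p → gen (inj₂ p))
  γχ = quotient χ (γ↓ ∨ χ) (λ p → gen (inj₂ p))

  βχ∈B : InBooleanCenter (A / χ) βχ
  βχ∈B = γχ
    , (λ _ _ → ∨-isTotal-mono β↓ γ↓ (pullback χ (βχ ∨ γχ)) β∨γ-total
        (λ p → gen (inj₁ (gen (inj₁ p)))) (λ p → gen (inj₂ (gen (inj₁ p)))) _ _)
    , (λ δ p → Congruence.contains-≈ δ (∨-preserves-complements modular A A∈V β↓ γ↓ χ β∨γ-total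
        (λ q → θ⊆χ (β∧γ⊆θ q)) p))

  lift-χ = χ-CBLP βχ βχ∈B
  α        = proj₁ lift-χ
  α′       = proj₁ (proj₁ (proj₂ lift-χ))
  α∨α′-max = proj₁ (proj₂ (proj₁ (proj₂ lift-χ)))
  α∧α′-min = proj₂ (proj₂ (proj₁ (proj₂ lift-χ)))

  α∨χ⊆β∨χ : α ∨ χ ⊆ β↓ ∨ χ
  α∨χ⊆β∨χ = proj₁ (proj₂ (proj₂ lift-χ))

  β∨χ⊆α∨χ : β↓ ∨ χ ⊆ α ∨ χ
  β∨χ⊆α∨χ = proj₂ (proj₂ (proj₂ lift-χ))

  χ⊆maximal : ∀ μ → IsMax μ → θ ⊆ μ → χ ⊆ μ
  χ⊆maximal μ max θ⊆μ = proj₂ (proj₁ max≐ {μ} (max , θ⊆μ))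

  α∨θ∨γ-total : IsTotal ((α ∨ θ) ∨ γ↓)
  α∨θ∨γ-total = total-if-no-maximal ((α ∨ θ) ∨ γ↓) λ μ max κ⊆μ →
    let χ⊆μ = χ⊆maximal μ max (λ p → κ⊆μ (gen (inj₁ (gen (inj₂ p)))))
        α∨χ⊆μ = ∨-least {α = α} {χ} μ (λ p → κ⊆μ (gen (inj₁ (gen (inj₁ p))))) χ⊆μ
    in ∨-isTotal-mono β↓ γ↓ μ β∨γ-total
         (λ p → α∨χ⊆μ (β∨χ⊆α∨χ (gen (inj₁ p)))) (λ p → κ⊆μ (gen (inj₂ p)))

  β∨α′-total : IsTotal (β↓ ∨ α′)
  β∨α′-total = total-if-no-maximal (β↓ ∨ α′) λ μ max κ⊆μ →
    let χ⊆μ = χ⊆maximal μ max (λ p → κ⊆μ (gen (inj₁ (Congruence.contains-≈ β p))))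
        β∨χ⊆μ = ∨-least {α = β↓} {χ} μ (λ p → κ⊆μ (gen (inj₁ p))) χ⊆μ
    in ∨-isTotal-mono α α′ μ (λ _ _ → α∨α′-max ∇ (lift tt))
         (λ p → β∨χ⊆μ (α∨χ⊆β∨χ (gen (inj₁ p)))) (λ p → κ⊆μ (gen (inj₂ p)))

  lifted : quotient θ (α ∨ θ) (λ p → gen (inj₂ p)) ≐ β
  lifted =
      ∨-least {α = α} {θ} β↓
        -- Here `α′` is cancelled; the reverse inclusion cancels `γ↓`.
        (comaximal-cancel modular A A∈V β↓ α′ α β∨α′-total (α∧α′-min β↓))
        (Congruence.contains-≈ β)
    , comaximal-cancel modular A A∈V (α ∨ θ) γ↓ β↓ α∨θ∨γ-total (λ p → gen (inj₂ (β∧γ⊆θ p)))
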